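{- Let $\ell,m$ be positive integers and let $S(\ell,m)$ be the $(\ell+m)\times(\ell+m)$ coloring matrix whose first $\ell$ rows consist entirely of ones and whose remaining $m$ rows consist entirely of zeroes. Then for all $n>1$, $$t_{S(\ell,m)}(n)=\sum_{k=1}^{n-1}N_{n-1,k}\,\ell^{n-k}(\ell+m)^k=\sum_{k=1}^{n-1}\frac{1}{n-1}\binom{n-1}{k}\binom{n-1}{k-1}\ell^{n-k}(\ell+m)^k.$$
   Context: A plane tree is an unlabeled rooted tree in which the children of every vertex are linearly ordered. A coloring matrix is a square matrix $A=(a_{ij})$ with entries in $\{0,1\}$. An $A$-coloring of a plane tree assigns to each vertex a color (an index of a row of $A$) such that whenever a vertex of color $j$ is a child of a vertex of color $i$, $a_{ij}=1$. Let $t_A(n)$ be the number of pairs (plane tree with $n$ vertices, $A$-coloring of it). $N_{n,k}=\frac1n\binom{n}{k}\binom{n}{k-1}$ denotes the Narayana numbers. -}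

module Defs where

open import Data.Fin.Base using (Fin; splitAt)
open import Data.Fin.Patterns using (0F; 1F)
open import Data.Integer.Base using (+_)
open import Data.List.Base using (List; []; _∷_; length; lookup; foldr; map; applyUpTo)
open import Data.Nat.Base using (ℕ; suc; _+_; _∸_; _<_; s≤s; NonZero)
open import Data.Nat.Combinatorics using (_C_)
open import Data.Rational.Base as ℚ using (ℚ; 0ℚ)
open import Data.Sum.Base using ([_,_]′)
open import Function.Base using (const)
open import Function.Bundles using (Inverse)
open import Level using (0ℓ)
open import Relation.Binary.Bundles using (Setoid)
open import Relation.Binary.PropositionalEquality using (_≡_; refl; sym; trans; setoid)

data PlaneTree : Set where
  node : List PlaneTree → PlaneTree

mutual
  size : PlaneTree → ℕ
  size (node ts) = suc (forestSize ts)

  forestSize : List PlaneTree → ℕ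
  forestSize []       = 0
  forestSize (t ∷ ts) = size t + forestSize ts

-- A vertex is given by the path leading to it from the root.
data Vertex : PlaneTree → Set where
  root  : ∀ {t} → Vertex t
  below : ∀ {ts} (i : Fin (length ts)) → Vertex (lookup ts i) → Vertex (node ts)

infix 4 _ChildOf_

data _ChildOf_ : ∀ {t} → Vertex t → Vertex t → Set where
  here  : ∀ {ts} (i : Fin (length ts)) → below {ts} i root ChildOf root
  there : ∀ {ts} (i : Fin (length ts)) {v u : Vertex (lookup ts i)} →
          v ChildOf u → below {ts} i v ChildOf below i u

-- The entries 0F and 1F of Fin 2 stand for the numbers 0 and 1.
ColoringMatrix : ℕ → Set
ColoringMatrix r = Fin r → Fin r → Fin 2

record Coloring {r : ℕ} (A : ColoringMatrix r) (t : PlaneTree) : Set where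
  field
    color  : Vertex t → Fin r
    proper : ∀ {u v} → v ChildOf u → A (color u) (color v) ≡ 1F

open Coloring public

record ColoredTree {r : ℕ} (A : ColoringMatrix r) (n : ℕ) : Set where
  constructor colored
  field
    tree     : PlaneTree
    size≡    : size tree ≡ n
    coloring : Coloring A tree

-- Colorings are functions, so they are compared pointwise; the proofs that
-- the size is n and that the coloring is proper are ignored.
data _≈_ {r} {A : ColoringMatrix r} {n} : ColoredTree A n → ColoredTree A n → Set where
  same : ∀ {t p q} {c d : Coloring A t} →
         (∀ v → color c v ≡ color d v) → colored t p c ≈ colored t q d

coloredTrees : ∀ {r} → ColoringMatrix r → ℕ → Setoid 0ℓ 0ℓ
coloredTrees A n = record
  { Carrier       = ColoredTree A n
  ; _≈_           = _≈_
  ; isEquivalence = record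
    { refl  = same (λ _ → refl)
    ; sym   = λ { (same e) → same (λ v → sym (e v)) }
    ; trans = λ { (same e) (same f) → same (λ v → trans (e v) (f v)) }
    }
  }

-- IsTreeCount A n N expresses t_A(n) = N.
IsTreeCount : ∀ {r} → ColoringMatrix r → ℕ → ℕ → Set
IsTreeCount A n N = Inverse (coloredTrees A n) (setoid (Fin N))

S : (ℓ m : ℕ) → ColoringMatrix (ℓ + m)
S ℓ m i j = [ const 1F , const 0F ]′ (splitAt ℓ i)

fromℕ : ℕ → ℚ
fromℕ n = + n ℚ./ 1

-- ∑₁ N f = f 1 + ⋯ + f N
∑₁ : ℕ → (ℕ → ℚ) → ℚ
∑₁ N f = foldr ℚ._+_ 0ℚ (map f (applyUpTo suc N))

-- Meant for k ≥ 1.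
narayana : (n k : ℕ) .{{_ : NonZero n}} → ℚ
narayana n k = (+ 1 ℚ./ n) ℚ.* fromℕ (n C k) ℚ.* fromℕ (n C (k ∸ 1))

1<n⇒n∸1≢0 : ∀ {n} → 1 < n → NonZero (n ∸ 1)
1<n⇒n∸1≢0 (s≤s (s≤s _)) = _

{-# OPTIONS --safe #-}

-- A vertex with a child must take one of the ℓ colors whose row is all ones, a leaf may take any
-- of the ℓ + m colors.  Walking around a forest gives a Dyck word in which the down-step leaving
-- a vertex directly follows its up-step exactly for leaves, so a colored forest is a Dyck word
-- whose down-steps have weight y = ℓ + m after an up-step and x = ℓ after a down-step.  Let Q r h
-- be the weight of all completions from height h with r up-steps left, after a down-step.  Then
--   Q (r+1) h + x Q r h = x Q (r+1) (h-1) + Q r (h+1) + y Q r h,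
-- and by Pascal's rule any sum over j of C(r, j+a) C(r+h+1, j+b) x^(r+h-j) y^(j+1) obeys the same
-- recurrence (with r shifted by one).  Matching the boundary values,
--   Q (r+1) h = ∑_j [C(r, j) C(r+h+1, j+1) - C(r, j+1) C(r+h+1, j)] x^(r+h-j) y^(j+1),
-- whose coefficients for h = 0 are the Narayana numbers.
module Submission where

open import Defs
open import Data.Fin.Base using (Fin; zero; suc; splitAt; _↑ˡ_)
open import Data.Fin.Patterns using (0F; 1F)
open import Data.Fin.Properties using (1↔⊤; +↔⊎; *↔×; splitAt-↑ˡ; splitAt⁻¹-↑ˡ)
import Data.Integer.Base as ℤ
open import Data.Integer.Properties using (pos-*)
import Data.Integer.Tactic.RingSolver as ℤ-Solver
open import Data.List.Base using (List; []; _∷_; map; foldr; lookup; applyUpTo)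
open import Data.List.Properties using (map-applyUpTo)
open import Data.Nat.Base using (ℕ; zero; suc; _+_; _*_; _∸_; _^_; _≤_; _<_; z≤n; s≤s)
open import Data.Nat.Combinatorics using (_C_; nCk+nC[k+1]≡[n+1]C[k+1]; nC1≡n; k>n⇒nCk≡0)
open import Data.Nat.ListAction using (sum)
open import Data.Nat.Properties
open import Data.Nat.Tactic.RingSolver using (solve-∀)
open import Data.Product.Base using (∃-syntax; _×_; _,_; proj₁; proj₂)
open import Data.Product.Function.NonDependent.Propositional using (_×-↔_)
open import Data.Rational.Base using (0ℚ; 1ℚ; fromℚᵘ; _/_) renaming (_*_ to _*ℚ_; _+_ to _+ℚ_)
import Data.Rational.Properties as ℚ
open import Data.Rational.Unnormalised.Base as ℚᵘ using (mkℚᵘ; *≡*)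
import Data.Rational.Unnormalised.Properties as ℚᵘ
open import Data.Sum.Base using (_⊎_; inj₁; inj₂; [_,_]′)
open import Data.Sum.Function.Propositional using (_⊎-↔_)
open import Data.Unit.Base using (⊤; tt)
open import Data.Vec.Base using (Vec; []; _∷_)
open import Function.Base using (_∘_; const)
open import Function.Bundles using (Inverse; _↔_)
open import Function.Construct.Composition using (_↔-∘_) renaming (inverse to _⟫_)
open import Function.Construct.Identity using (↔-id)
open import Function.Construct.Symmetry using (↔-sym)
open import Relation.Binary.PropositionalEquality

-- Binomial coefficients

pascal : ∀ n k → suc n C suc k ≡ n C k + n C suc k
pascal n k = sym (nCk+nC[k+1]≡[n+1]C[k+1] n k)

*-pascal : ∀ a n k → a * (n C k) + a * (n C suc k) ≡ a * (suc n C suc k)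
*-pascal a n k = trans (sym (*-distribˡ-+ a (n C k) (n C suc k))) (cong (a *_) (sym (pascal n k)))

absorption : ∀ n k → suc k * (suc n C suc k) ≡ suc n * (n C k)
absorption zero    zero    = refl
absorption zero    (suc k) rewrite k>n⇒nCk≡0 {1} {suc (suc k)} (s≤s (s≤s z≤n)) | k>n⇒nCk≡0 {0} {suc k} (s≤s z≤n) = *-zeroʳ k
absorption (suc n) zero    rewrite nC1≡n (suc (suc n)) = *-comm 1 (suc (suc n))
absorption (suc n) (suc k) = begin
  suc (suc k) * (suc (suc n) C suc (suc k))
    ≡⟨ cong (suc (suc k) *_) (pascal (suc n) (suc k)) ⟩
  suc (suc k) * (c + suc n C suc (suc k))
    ≡⟨ expand (suc k) c (suc n C suc (suc k)) ⟩
  c + (suc k * c + suc (suc k) * (suc n C suc (suc k)))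
    ≡⟨ cong (c +_) (cong₂ _+_ (absorption n k) (absorption n (suc k))) ⟩
  c + (suc n * (n C k) + suc n * (n C suc k))
    ≡⟨ cong (c +_) (*-pascal (suc n) n k) ⟩
  suc (suc n) * c ∎
  where
  open ≡-Reasoning
  c = suc n C suc k
  expand : ∀ k c e → suc k * (c + e) ≡ c + (k * c + suc k * e)
  expand = solve-∀

-- Subtraction-free form of `(k+1) C(n, k+1) = (n-k) C(n, k)`. In the inductive case both terms on
-- the left reduce by `absorption`, and Pascal's rule merges the results.
absorption′ : ∀ n k → suc k * (n C suc k) + k * (n C k) ≡ n * (n C k)
absorption′ zero    zero    = refl
absorption′ zero    (suc k) rewrite k>n⇒nCk≡0 {0} {suc (suc k)} (s≤s z≤n) | k>n⇒nCk≡0 {0} {suc k} (s≤s z≤n) | *-zeroʳ k = refl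
absorption′ (suc n) zero    = trans (+-identityʳ _) (absorption n 0)
absorption′ (suc n) (suc k) = begin
  suc (suc k) * (suc n C suc (suc k)) + suc k * (suc n C suc k)
    ≡⟨ cong₂ _+_ (absorption n (suc k)) (absorption n k) ⟩
  suc n * (n C suc k) + suc n * (n C k)
    ≡⟨ +-comm (suc n * (n C suc k)) _ ⟩
  suc n * (n C k) + suc n * (n C suc k)
    ≡⟨ *-pascal (suc n) n k ⟩
  suc n * (suc n C suc k) ∎
  where open ≡-Reasoning

-- The positive and the negative part of the coefficient in the closed form of Q (r+1) h, where `N`
-- is r + h + 1. They are kept apart so that all identities stay within the natural numbers.
upper lower : ℕ → ℕ → ℕ → ℕ
upper r N j = (r C j) * (N C suc j)
lower r N j = (r C suc j) * (N C j)

-- For h = 0 the difference of `upper` and `lower` is the Narayana number N_{r+1,j+1}; here the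
-- denominator is cleared and the negative part moved to the other side.
narayana-upper-lower : ∀ r j →
  suc r * upper r (suc r) j ≡ (suc r C suc j) * (suc r C j) + suc r * lower r (suc r) j
narayana-upper-lower r j =
  +-cancelʳ-≡ _ _ _
    (combine (suc r) (suc j) j c d (r C j) (r C suc j) (absorption r j) (absorption′ (suc r) j) (pascal r j) refl)
  where
  open ≡-Reasoning
  c = suc r C suc j
  d = suc r C j
  -- Both sides are enlarged by `k * c * d`. Absorption turns `n * p` into `k * c`, so that `c`
  -- factors out and `absorption′` applies to `k * c + j * d`; the leftover `c * d` comes from
  -- `k ≡ suc j`.
  combine : ∀ n k j c d p q → k * c ≡ n * p → k * c + j * d ≡ n * d → c ≡ p + q → k ≡ suc j →
            n * (p * c) + k * c * d ≡ (c * d + n * (q * d)) + k * c * d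
  combine n k j c d p q e₁ e₂ e₃ refl = begin
    n * (p * c) + k * c * d
      ≡⟨ cong (_+ k * c * d) (trans (sym (*-assoc n p c)) (cong (_* c) (sym e₁))) ⟩
    k * c * c + k * c * d           ≡⟨ s₁ j c d ⟩
    c * (k * c + j * d) + c * d     ≡⟨ cong (λ z → c * z + c * d) e₂ ⟩
    c * (n * d) + c * d             ≡⟨ cong (λ z → z * (n * d) + c * d) e₃ ⟩
    (p + q) * (n * d) + c * d       ≡⟨ s₂ p q n d c ⟩
    (c * d + n * (q * d)) + n * p * d ≡⟨ cong (λ z → (c * d + n * (q * d)) + z * d) e₁ ⟨
    (c * d + n * (q * d)) + k * c * d ∎
    where
    s₁ : ∀ j c d → suc j * c * c + suc j * c * d ≡ c * (suc j * c + j * d) + c * d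
    s₁ = solve-∀
    s₂ : ∀ p q n d c → (p + q) * (n * d) + c * d ≡ (c * d + n * (q * d)) + n * p * d
    s₂ = solve-∀

shift : (ℕ → ℕ) → ℕ → ℕ
shift f zero    = 0
shift f (suc j) = f j

-- Taking differences in both `r` and `N` lowers the bottom index of each binomial factor by one, by
-- Pascal's rule. The mixed difference of the product is therefore the product at j - 1, which is
-- what `shift` supplies, with 0 at j = 0.
ProductRecurrence : (ℕ → ℕ → ℕ → ℕ) → Set
ProductRecurrence f = ∀ r N j →
  f (suc r) (suc N) j + f r N j ≡ f (suc r) N j + f r (suc N) j + shift (f r N) j

upper-recurrence : ProductRecurrence upper
upper-recurrence r N zero rewrite pascal N 0 = s (N C 1)
  where
  s : ∀ e → 1 * (1 + e) + 1 * e ≡ 1 * e + 1 * (1 + e) + 0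
  s = solve-∀
upper-recurrence r N (suc j) rewrite pascal N (suc j) | pascal r j =
  s (r C j) (r C suc j) (N C suc j) (N C suc (suc j))
  where
  s : ∀ a b c d → (a + b) * (c + d) + b * d ≡ (a + b) * d + b * (c + d) + a * c
  s = solve-∀

lower-recurrence : ProductRecurrence lower
lower-recurrence r N zero rewrite pascal r 0 = s (r C 1)
  where
  s : ∀ e → (1 + e) * 1 + e * 1 ≡ (1 + e) * 1 + e * 1 + 0
  s = solve-∀
lower-recurrence r N (suc j) rewrite pascal r (suc j) | pascal N j =
  s (r C suc j) (r C suc (suc j)) (N C j) (N C suc j)
  where
  s : ∀ a b c d → (a + b) * (c + d) + b * d ≡ (a + b) * d + b * (c + d) + a * c
  s = solve-∀

upper≡0 : ∀ {r j} N → r < j → upper r N j ≡ 0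
upper≡0 N r<j rewrite k>n⇒nCk≡0 r<j = refl

lower≡0 : ∀ {r j} N → r < j → lower r N j ≡ 0
lower≡0 N r<j rewrite k>n⇒nCk≡0 (m<n⇒m<1+n r<j) = refl

sum-applyUpTo-*ʳ : ∀ (f : ℕ → ℕ) c d → sum (applyUpTo (λ j → f j * c) d) ≡ sum (applyUpTo f d) * c
sum-applyUpTo-*ʳ f c zero    = refl
sum-applyUpTo-*ʳ f c (suc d) =
  trans (cong (f 0 * c +_) (sum-applyUpTo-*ʳ (f ∘ suc) c d)) (sym (*-distribʳ-+ c (f 0) _))

applyUpTo-cong : ∀ {f g : ℕ → ℕ} → (∀ j → f j ≡ g j) → ∀ d → applyUpTo f d ≡ applyUpTo g d
applyUpTo-cong f≗g zero    = refl
applyUpTo-cong f≗g (suc d) = cong₂ _∷_ (f≗g 0) (applyUpTo-cong (f≗g ∘ suc) d)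

-- Weighted Dyck words

module Weights (x y : ℕ) where

  -- eval d f = ∑_{j ≤ d} f j · x^(d-j) · y^j
  eval : ℕ → (ℕ → ℕ) → ℕ
  eval zero    f = f 0
  eval (suc d) f = x ^ suc d * f 0 + y * eval d (f ∘ suc)

  eval-cong : ∀ d {f g} → (∀ j → f j ≡ g j) → eval d f ≡ eval d g
  eval-cong zero    f≗g = f≗g 0
  eval-cong (suc d) f≗g = cong₂ (λ a b → x ^ suc d * a + y * b) (f≗g 0) (eval-cong d (f≗g ∘ suc))

  eval-+ : ∀ d f g → eval d (λ j → f j + g j) ≡ eval d f + eval d g
  eval-+ zero    f g = refl
  eval-+ (suc d) f g rewrite eval-+ d (f ∘ suc) (g ∘ suc) =
    s (x ^ suc d) (f 0) (g 0) y (eval d (f ∘ suc)) (eval d (g ∘ suc))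
    where
    s : ∀ p a b y c d → p * (a + b) + y * (c + d) ≡ p * a + y * c + (p * b + y * d)
    s = solve-∀

  eval-* : ∀ d c f → eval d (λ j → c * f j) ≡ c * eval d f
  eval-* zero    c f = refl
  eval-* (suc d) c f rewrite eval-* d c (f ∘ suc) = s (x ^ suc d) c (f 0) y (eval d (f ∘ suc))
    where
    s : ∀ p c a y e → p * (c * a) + y * (c * e) ≡ c * (p * a + y * e)
    s = solve-∀

  -- Without the term in `y ^ suc d`, every remaining term contains a factor `x`.
  eval-suc : ∀ d f → f (suc d) ≡ 0 → eval (suc d) f ≡ x * eval d f
  eval-suc zero    f f1≡0 rewrite f1≡0 = s x (f 0) y
    where
    s : ∀ x a y → x * 1 * a + y * 0 ≡ x * a
    s = solve-∀
  eval-suc (suc d) f f≡0 rewrite eval-suc d (f ∘ suc) f≡0 = s x (x ^ suc d) (f 0) y (eval d (f ∘ suc))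
    where
    s : ∀ x p a y e → x * p * a + y * (x * e) ≡ x * (p * a + y * e)
    s = solve-∀

  eval-shift : ∀ d f → eval (suc d) (shift f) ≡ y * eval d f
  eval-shift d f rewrite *-zeroʳ (x ^ suc d) = refl

  -- The coefficientwise recurrence summed over j: `shift` becomes multiplication by `y`, and the
  -- vanishing top coefficient of `f r N` lets one `x` be split off, so the shape matches the
  -- recurrence for Q.
  eval-recurrence : ∀ {f} → ProductRecurrence f → ∀ r N d → f r N (suc d) ≡ 0 →
    eval (suc d) (f (suc r) (suc N)) + x * eval d (f r N)
      ≡ eval (suc d) (f (suc r) N) + eval (suc d) (f r (suc N)) + y * eval d (f r N)
  eval-recurrence {f} rec r N d f≡0 = begin
    eval (suc d) (f (suc r) (suc N)) + x * eval d (f r N)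
      ≡⟨ cong (eval (suc d) (f (suc r) (suc N)) +_) (eval-suc d (f r N) f≡0) ⟨
    eval (suc d) (f (suc r) (suc N)) + eval (suc d) (f r N)
      ≡⟨ eval-+ (suc d) (f (suc r) (suc N)) (f r N) ⟨
    eval (suc d) (λ j → f (suc r) (suc N) j + f r N j)
      ≡⟨ eval-cong (suc d) (rec r N) ⟩
    eval (suc d) (λ j → f (suc r) N j + f r (suc N) j + shift (f r N) j)
      ≡⟨ eval-+ (suc d) (λ j → f (suc r) N j + f r (suc N) j) (shift (f r N)) ⟩
    eval (suc d) (λ j → f (suc r) N j + f r (suc N) j) + eval (suc d) (shift (f r N))
      ≡⟨ cong₂ _+_ (eval-+ (suc d) (f (suc r) N) (f r (suc N))) (eval-shift d (f r N)) ⟩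
    eval (suc d) (f (suc r) N) + eval (suc d) (f r (suc N)) + y * eval d (f r N) ∎
    where open ≡-Reasoning

  -- Both count the completions of a Dyck word with r up-steps to come, after a down-step and an
  -- up-step respectively.  #D r h starts at height h, but #U r h starts at height h + 1 and has
  -- the vertex on top still open.
  mutual
    #D : ℕ → ℕ → ℕ
    #D zero    zero    = 1
    #D zero    (suc h) = x * #D zero h
    #D (suc r) zero    = #U r zero
    #D (suc r) (suc h) = x * #D (suc r) h + #U r (suc h)

    #U : ℕ → ℕ → ℕ
    #U zero    h = y * #D zero h
    #U (suc r) h = y * #D (suc r) h + #U r (suc h)

  #D-zero : ∀ h → #D 0 h ≡ x ^ h
  #D-zero zero    = refl
  #D-zero (suc h) = cong (x *_) (#D-zero h)

  eval-const : ∀ d f → (∀ j → f (suc j) ≡ 0) → eval d f ≡ x ^ d * f 0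
  eval-const zero    f f≡0 = sym (*-identityˡ (f 0))
  eval-const (suc d) f f≡0 rewrite eval-const d (f ∘ suc) (f≡0 ∘ suc) | f≡0 0 =
    s (x ^ suc d * f 0) y (x ^ d)
    where
    s : ∀ p y q → p + y * (q * 0) ≡ p
    s = solve-∀

  -- The closed form of Q (r+1) h with one `y` factored out, by induction along the recurrence for
  -- Q. The degree `d` is a separate argument, so only the equation `d ≡ r + h` has to be adjusted
  -- in the recursive calls.
  #D-suc : ∀ r h d → d ≡ r + h →
    #D (suc r) h + y * eval d (lower r (suc d)) ≡ y * eval d (upper r (suc d))
  #D-suc zero h .h refl
    rewrite eval-const h (upper 0 (suc h)) (λ j → upper≡0 {0} {suc j} (suc h) (s≤s z≤n))
          | eval-const h (lower 0 (suc h)) (λ j → lower≡0 {0} {suc j} (suc h) (s≤s z≤n))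
          | nC1≡n (suc h) | *-zeroʳ (x ^ h) | *-zeroʳ y | +-identityʳ (#D 1 h) | +-identityʳ h
          = base h
    where
    s : ∀ x y p h → x * (y * (p * suc h)) + y * (x * p) ≡ y * (x * p * suc (suc h))
    s = solve-∀
    -- The only up-step left creates a leaf of weight `y` and can start at any of the heights 0 to
    -- `h`; the other `h` down-steps have weight `x`.
    base : ∀ h → #D 1 h ≡ y * (x ^ h * suc h)
    base zero    = refl
    base (suc h) rewrite base h | #D-zero h = s x y (x ^ h) h
  #D-suc (suc r) h (suc d) e = main h (suc-injective e)
    where
    N = suc d
    -- The letters q, a, b stand for values of `#D`, `upper` sums and `lower` sums. Index 1 is the
    -- new case, 0 has one up-step less, m is the term from height h - 1 including its factor `x`,
    -- and h is the term from height h + 1. The three recurrences and three known cases give the new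
    -- case after cancelling `x * (y * a₀)`.
    finish : ∀ q₁ q₀ qₘ qₕ a₁ a₀ aₘ aₕ b₁ b₀ bₘ bₕ →
      q₁ + x * q₀ ≡ qₘ + qₕ + y * q₀ →
      q₀ + y * b₀ ≡ y * a₀ → qₘ + y * bₘ ≡ y * aₘ → qₕ + y * bₕ ≡ y * aₕ →
      a₁ + x * a₀ ≡ aₘ + aₕ + y * a₀ → b₁ + x * b₀ ≡ bₘ + bₕ + y * b₀ →
      q₁ + y * b₁ ≡ y * a₁
    finish q₁ q₀ qₘ qₕ a₁ a₀ aₘ aₕ b₁ b₀ bₘ bₕ eq e₀ eₘ eₕ ea eb = +-cancelʳ-≡ (x * (y * a₀)) _ _ (begin
      q₁ + y * b₁ + x * (y * a₀)                         ≡⟨ cong (λ z → q₁ + y * b₁ + x * z) e₀ ⟨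
      q₁ + y * b₁ + x * (q₀ + y * b₀)                    ≡⟨ s₁ q₁ y b₁ x q₀ b₀ ⟩
      (q₁ + x * q₀) + y * (b₁ + x * b₀)                  ≡⟨ cong₂ (λ u v → u + y * v) eq eb ⟩
      (qₘ + qₕ + y * q₀) + y * (bₘ + bₕ + y * b₀)        ≡⟨ s₂ qₘ qₕ y q₀ bₘ bₕ b₀ ⟩
      (qₘ + y * bₘ) + (qₕ + y * bₕ) + y * (q₀ + y * b₀)  ≡⟨ cong₂ _+_ (cong₂ _+_ eₘ eₕ) (cong (y *_) e₀) ⟩
      y * aₘ + y * aₕ + y * (y * a₀)                     ≡⟨ s₃ y aₘ aₕ a₀ ⟩
      y * (aₘ + aₕ + y * a₀)                             ≡⟨ cong (y *_) ea ⟨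
      y * (a₁ + x * a₀)                                  ≡⟨ s₄ y a₁ x a₀ ⟩
      y * a₁ + x * (y * a₀)                              ∎)
      where
      open ≡-Reasoning
      s₁ : ∀ q₁ y b₁ x q₀ b₀ → q₁ + y * b₁ + x * (q₀ + y * b₀) ≡ (q₁ + x * q₀) + y * (b₁ + x * b₀)
      s₁ = solve-∀
      s₂ : ∀ qₘ qₕ y q₀ bₘ bₕ b₀ → (qₘ + qₕ + y * q₀) + y * (bₘ + bₕ + y * b₀)
           ≡ (qₘ + y * bₘ) + (qₕ + y * bₕ) + y * (q₀ + y * b₀)
      s₂ = solve-∀
      s₃ : ∀ y aₘ aₕ a₀ → y * aₘ + y * aₕ + y * (y * a₀) ≡ y * (aₘ + aₕ + y * a₀)
      s₃ = solve-∀
      s₄ : ∀ y a₁ x a₀ → y * (a₁ + x * a₀) ≡ y * a₁ + x * (y * a₀)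
      s₄ = solve-∀

    step : ∀ h → d ≡ r + h → ∀ qₘ → #D (suc (suc r)) h ≡ qₘ + #U (suc r) h →
      qₘ + y * eval (suc d) (lower (suc r) N) ≡ y * eval (suc d) (upper (suc r) N) →
      #D (suc (suc r)) h + y * eval (suc d) (lower (suc r) (suc N)) ≡ y * eval (suc d) (upper (suc r) (suc N))
    step h d≡r+h qₘ eq eₘ =
      finish _ (#D (suc r) h) qₘ (#D (suc r) (suc h)) _ (eval d (upper r N)) _ (eval (suc d) (upper r (suc N)))
        _ (eval d (lower r N)) (eval (suc d) (lower (suc r) N)) (eval (suc d) (lower r (suc N)))
        -- `#U` is eliminated: `#U (suc r) h` unfolds to `y * #D (suc r) h + #U r (suc h)`, and
        -- adding `x * #D (suc r) h` to its last term gives `#D (suc r) (suc h)`.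
        (trans (cong (_+ x * #D (suc r) h) eq) (s qₘ y (#D (suc r) h) (#U r (suc h)) x))
        (#D-suc r h d d≡r+h) eₘ (#D-suc r (suc h) (suc d) (trans (cong suc d≡r+h) (sym (+-suc r h))))
        (eval-recurrence upper-recurrence r N d (upper≡0 N r<1+d))
        (eval-recurrence lower-recurrence r N d (lower≡0 N r<1+d))
      where
      r<1+d : r < suc d
      r<1+d = s≤s (subst (r ≤_) (sym d≡r+h) (m≤m+n r h))
      s : ∀ qₘ y q u x → qₘ + (y * q + u) + x * q ≡ qₘ + (x * q + u) + y * q
      s = solve-∀

    main : ∀ h → d ≡ r + h →
      #D (suc (suc r)) h + y * eval (suc d) (lower (suc r) (suc N)) ≡ y * eval (suc d) (upper (suc r) (suc N))
    -- No down-step is possible from height 0, so `qₘ` is 0. The closed form agrees: here `N` equals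
    -- `suc r`, and `upper` and `lower` coincide by commutativity.
    main zero    d≡r+h = step zero d≡r+h 0 refl
      (cong (y *_) (eval-cong (suc d) λ j → subst (λ n → lower (suc r) n j ≡ upper (suc r) n j) r≡d (*-comm (suc r C suc j) (suc r C j))))
      where
      r≡d : suc r ≡ N
      r≡d = cong suc (sym (trans d≡r+h (+-identityʳ r)))
    -- The known case at height `h` has degree `d`; the factor `x` of the down-step raises it to
    -- `suc d`, since the coefficients at `suc d` vanish.
    main (suc h) d≡r+h = step (suc h) d≡r+h _ refl (begin
        x * q + y * eval (suc d) (lower (suc r) N)
          ≡⟨ cong (λ z → x * q + y * z) (eval-suc d _ (lower≡0 N 1+r<1+d)) ⟩
        x * q + y * (x * eval d (lower (suc r) N))
          ≡⟨ s x q y (eval d (lower (suc r) N)) ⟩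
        x * (q + y * eval d (lower (suc r) N))
          ≡⟨ cong (x *_) (#D-suc (suc r) h d d≡1+r+h) ⟩
        x * (y * eval d (upper (suc r) N))
          ≡⟨ s′ x y (eval d (upper (suc r) N)) ⟩
        y * (x * eval d (upper (suc r) N))
          ≡⟨ cong (y *_) (eval-suc d _ (upper≡0 N 1+r<1+d)) ⟨
        y * eval (suc d) (upper (suc r) N) ∎)
      where
      open ≡-Reasoning
      q = #D (suc (suc r)) h
      d≡1+r+h : d ≡ suc r + h
      d≡1+r+h = trans d≡r+h (+-suc r h)
      1+r<1+d : suc r < suc d
      1+r<1+d = s≤s (subst (suc r ≤_) (sym d≡1+r+h) (m≤m+n (suc r) h))
      s : ∀ x q y e → x * q + y * (x * e) ≡ x * (q + y * e)
      s = solve-∀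
      s′ : ∀ x y e → x * (y * e) ≡ y * (x * e)
      s′ = solve-∀

  -- `#U r 0` is `#D (suc r) 0` by definition, so this is the case h = 0 of `#D-suc` combined with
  -- `narayana-upper-lower`.
  #U-narayana : ∀ r → suc r * #U r 0 ≡ y * eval r (λ j → (suc r C suc j) * (suc r C j))
  #U-narayana r = +-cancelʳ-≡ (suc r * (y * L)) _ _ (begin
    suc r * #U r 0 + suc r * (y * L)           ≡⟨ *-distribˡ-+ (suc r) (#U r 0) (y * L) ⟨
    suc r * (#U r 0 + y * L)                   ≡⟨ cong (suc r *_) (#D-suc r 0 r (sym (+-identityʳ r))) ⟩
    suc r * (y * eval r (upper r (suc r)))     ≡⟨ s (suc r) y _ ⟩
    y * (suc r * eval r (upper r (suc r)))     ≡⟨ cong (y *_) (eval-* r (suc r) _) ⟨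
    y * eval r (λ j → suc r * upper r (suc r) j)
      ≡⟨ cong (y *_) (eval-cong r (narayana-upper-lower r)) ⟩
    y * eval r (λ j → f j + suc r * lower r (suc r) j)
      ≡⟨ cong (y *_) (trans (eval-+ r f _) (cong (λ z → eval r f + z) (eval-* r (suc r) (lower r (suc r))))) ⟩
    y * (eval r f + suc r * L)                 ≡⟨ s′ y (eval r f) (suc r) L ⟩
    y * eval r f + suc r * (y * L)             ∎)
    where
    open ≡-Reasoning
    f : ℕ → ℕ
    f j = (suc r C suc j) * (suc r C j)
    L = eval r (lower r (suc r))
    s : ∀ n y e → n * (y * e) ≡ y * (n * e)
    s = solve-∀
    s′ : ∀ y e n l → y * (e + n * l) ≡ y * e + n * (y * l)
    s′ = solve-∀

  sum≡eval : ∀ d f → sum (applyUpTo (λ j → f j * x ^ (suc d ∸ j) * y ^ suc j) (suc d)) ≡ x * (y * eval d f)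
  sum≡eval zero    f = s (f 0) x y
    where
    s : ∀ a x y → a * (x * 1) * (y * 1) + 0 ≡ x * (y * a)
    s = solve-∀
  sum≡eval (suc d) f = begin
    f 0 * x ^ suc (suc d) * y ^ 1 + sum (applyUpTo (λ j → f (suc j) * x ^ (suc d ∸ j) * y ^ suc (suc j)) (suc d))
      ≡⟨ cong (λ z → f 0 * x ^ suc (suc d) * y ^ 1 + sum z)
           (applyUpTo-cong (λ j → s₁ (f (suc j)) (x ^ (suc d ∸ j)) y (y ^ suc j)) (suc d)) ⟩
    f 0 * x ^ suc (suc d) * y ^ 1 + sum (applyUpTo (λ j → f (suc j) * x ^ (suc d ∸ j) * y ^ suc j * y) (suc d))
      ≡⟨ cong (f 0 * x ^ suc (suc d) * y ^ 1 +_)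
           (trans (sum-applyUpTo-*ʳ (λ j → f (suc j) * x ^ (suc d ∸ j) * y ^ suc j) y (suc d)) (cong (_* y) (sum≡eval d (f ∘ suc)))) ⟩
    f 0 * x ^ suc (suc d) * y ^ 1 + x * (y * eval d (f ∘ suc)) * y
      ≡⟨ s₂ (f 0) x (x ^ suc d) y (eval d (f ∘ suc)) ⟩
    x * (y * (x ^ suc d * f 0 + y * eval d (f ∘ suc))) ∎
    where
    open ≡-Reasoning
    s₁ : ∀ a p y q → a * p * (y * q) ≡ a * p * q * y
    s₁ = solve-∀
    s₂ : ∀ a x p y e → a * (x * p) * (y * 1) + x * (y * e) * y ≡ x * (y * (p * a + y * e))
    s₂ = solve-∀

-- Cardinalities of products and sums

Fin-× : ∀ {a b} {B : Set} → B ↔ Fin b → (Fin a × B) ↔ Fin (a * b)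
Fin-× B↔ = ↔-sym *↔× ↔-∘ (↔-id _ ×-↔ B↔)

Fin-⊎ : ∀ {a b} {A B : Set} → A ↔ Fin a → B ↔ Fin b → (A ⊎ B) ↔ Fin (a + b)
Fin-⊎ A↔ B↔ = ↔-sym +↔⊎ ↔-∘ (A↔ ⊎-↔ B↔)

-- Colored trees as Dyck words

module Encoding (ℓ m : ℕ) where

  open Weights ℓ (ℓ + m) using (#D; #U)

  -- A normal form for properly colored trees: a vertex with children has its first child split off
  -- and a color in `Fin ℓ`, so properness is built in and propositional equality replaces pointwise
  -- comparison.
  data CTree : Set where
    leaf   : Fin (ℓ + m) → CTree
    branch : Fin ℓ → CTree → List CTree → CTree

  mutual
    shape : CTree → PlaneTree
    shape (leaf c)        = node []
    shape (branch c t ts) = node (shape t ∷ shapes ts)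

    shapes : List CTree → List PlaneTree
    shapes []       = []
    shapes (t ∷ ts) = shape t ∷ shapes ts

  mutual
    vertexColor : ∀ u → Vertex (shape u) → Fin (ℓ + m)
    vertexColor (leaf c)        root              = c
    vertexColor (branch c t ts) root              = c ↑ˡ m
    vertexColor (branch c t ts) (below zero v)    = vertexColor t v
    vertexColor (branch c t ts) (below (suc i) v) = vertexColors ts i v

    vertexColors : ∀ us i → Vertex (lookup (shapes us) i) → Fin (ℓ + m)
    vertexColors (u ∷ us) zero    v = vertexColor u v
    vertexColors (u ∷ us) (suc i) v = vertexColors us i v

  rowEntry : Fin ℓ ⊎ Fin m → Fin 2
  rowEntry = [ const 1F , const 0F ]′

  S-↑ˡ : ∀ (i : Fin ℓ) (j : Fin (ℓ + m)) → S ℓ m (i ↑ˡ m) j ≡ 1F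
  S-↑ˡ i j = cong rowEntry (splitAt-↑ˡ ℓ i m)

  mutual
    vertexColor-proper : ∀ u {v w} → w ChildOf v → S ℓ m (vertexColor u v) (vertexColor u w) ≡ 1F
    vertexColor-proper (leaf c)        (here ())
    vertexColor-proper (branch c t ts) (here i)            = S-↑ˡ c (vertexColor (branch c t ts) (below i root))
    vertexColor-proper (branch c t ts) (there zero w↓v)    = vertexColor-proper t w↓v
    vertexColor-proper (branch c t ts) (there (suc i) w↓v) = vertexColors-proper ts i w↓v

    vertexColors-proper : ∀ us i {v w} → w ChildOf v →
      S ℓ m (vertexColors us i v) (vertexColors us i w) ≡ 1F
    vertexColors-proper (u ∷ us) zero    w↓v = vertexColor-proper u w↓v
    vertexColors-proper (u ∷ us) (suc i) w↓v = vertexColors-proper us i w↓v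

  decode : ∀ u → Coloring (S ℓ m) (shape u)
  decode u = record { color = vertexColor u ; proper = vertexColor-proper u }

  topRow : ∀ s → rowEntry s ≡ 1F → Fin ℓ
  topRow (inj₁ i) _ = i

  topRow-unique : ∀ s p i → s ≡ inj₁ i → topRow s p ≡ i
  topRow-unique (inj₁ i) p .i refl = refl

  splitAt-topRow : ∀ s p → s ≡ inj₁ (topRow s p)
  splitAt-topRow (inj₁ i) p = refl

  restrict : ∀ {ts} → Coloring (S ℓ m) (node ts) → ∀ i → Coloring (S ℓ m) (lookup ts i)
  restrict c i = record { color = color c ∘ below i ; proper = proper c ∘ there i }

  -- The edge to the first child forces the row of the root's color to contain a one, which excludes
  -- the last `m` colors.
  parentColor : ∀ {t ts} → Coloring (S ℓ m) (node (t ∷ ts)) → Fin ℓ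
  parentColor c = topRow (splitAt ℓ (color c root)) (proper c (here zero))

  parentColor-↑ˡ : ∀ {t ts} (c : Coloring (S ℓ m) (node (t ∷ ts))) → parentColor c ↑ˡ m ≡ color c root
  parentColor-↑ˡ c = splitAt⁻¹-↑ˡ (splitAt-topRow (splitAt ℓ (color c root)) (proper c (here zero)))

  parentColor-unique : ∀ {t ts} (c : Coloring (S ℓ m) (node (t ∷ ts))) i →
    color c root ≡ i ↑ˡ m → parentColor c ≡ i
  parentColor-unique c i e =
    topRow-unique _ (proper c (here zero)) i (trans (cong (splitAt ℓ) e) (splitAt-↑ˡ ℓ i m))

  mutual
    encode : ∀ t → Coloring (S ℓ m) t → CTree
    encode (node [])       c = leaf (color c root)
    encode (node (t ∷ ts)) c =
      branch (parentColor c) (encode t (restrict c zero)) (encodes ts (restrict c ∘ suc))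

    encodes : ∀ ts → (∀ i → Coloring (S ℓ m) (lookup ts i)) → List CTree
    encodes []       c = []
    encodes (t ∷ ts) c = encode t (c zero) ∷ encodes ts (c ∘ suc)

  mutual
    -- Stated for every coloring that agrees pointwise with `vertexColor u`, because the restriction
    -- of `decode u` to a subtree agrees with the decoding of that subtree only in this sense.
    encode-decode : ∀ u (c : Coloring (S ℓ m) (shape u)) →
      (∀ v → color c v ≡ vertexColor u v) → encode (shape u) c ≡ u
    encode-decode (leaf i)        c e = cong leaf (e root)
    encode-decode (branch i t ts) c e
      rewrite parentColor-unique c i (e root)
            | encode-decode t (restrict c zero) (e ∘ below zero)
            | encodes-decode ts (restrict c ∘ suc) (λ j → e ∘ below (suc j)) = refl

    encodes-decode : ∀ us (c : ∀ i → Coloring (S ℓ m) (lookup (shapes us) i)) →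
      (∀ i v → color (c i) v ≡ vertexColors us i v) → encodes (shapes us) c ≡ us
    encodes-decode []       c e = refl
    encodes-decode (u ∷ us) c e =
      cong₂ _∷_ (encode-decode u (c zero) (e zero)) (encodes-decode us (c ∘ suc) (e ∘ suc))

  -- Equality of trees with vertex colors as an indexed family: matching on it identifies the two
  -- trees, so that colors never have to be transported along shape (encode t c) ≡ t.
  data SameTree (t : PlaneTree) (f : Vertex t → Fin (ℓ + m)) : ∀ t′ → (Vertex t′ → Fin (ℓ + m)) → Set where
    agree : ∀ {g} → (∀ v → f v ≡ g v) → SameTree t f t g

  data SameForest (ts : List PlaneTree) (f : ∀ i → Vertex (lookup ts i) → Fin (ℓ + m)) :
       ∀ ts′ → (∀ i → Vertex (lookup ts′ i) → Fin (ℓ + m)) → Set where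
    agree : ∀ {g} → (∀ i v → f i v ≡ g i v) → SameForest ts f ts g

  SameForest-∷ : ∀ {t ts t′ ts′} {f : ∀ i → Vertex (lookup (t ∷ ts) i) → Fin (ℓ + m)}
    {g : ∀ i → Vertex (lookup (t′ ∷ ts′) i) → Fin (ℓ + m)} →
    SameTree t (f zero) t′ (g zero) → SameForest ts (λ i → f (suc i)) ts′ (λ i → g (suc i)) →
    SameForest (t ∷ ts) f (t′ ∷ ts′) g
  SameForest-∷ (agree p) (agree q) = agree λ { zero → p ; (suc i) → q i }

  SameTree-node : ∀ {ts ts′} {f : Vertex (node ts) → Fin (ℓ + m)} {g : Vertex (node ts′) → Fin (ℓ + m)} →
    f root ≡ g root → SameForest ts (λ i v → f (below i v)) ts′ (λ i v → g (below i v)) →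
    SameTree (node ts) f (node ts′) g
  SameTree-node p (agree q) = agree λ { root → p ; (below i v) → q i v }

  mutual
    decode-encode : ∀ t c → SameTree (shape (encode t c)) (vertexColor (encode t c)) t (color c)
    decode-encode (node [])       c = SameTree-node refl (agree λ ())
    decode-encode (node (t ∷ ts)) c = SameTree-node (parentColor-↑ˡ c)
      (SameForest-∷ (decode-encode t (restrict c zero)) (decodes-encodes ts (restrict c ∘ suc)))

    decodes-encodes : ∀ ts c →
      SameForest (shapes (encodes ts c)) (vertexColors (encodes ts c)) ts (λ i → color (c i))
    decodes-encodes []       c = agree λ ()
    decodes-encodes (t ∷ ts) c = SameForest-∷ (decode-encode t (c zero)) (decodes-encodes ts (c ∘ suc))

  SameTree⇒≈ : ∀ {n t t′ p q} {c : Coloring (S ℓ m) t} {d : Coloring (S ℓ m) t′} →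
    SameTree t (color c) t′ (color d) → _≈_ {n = n} (colored t p c) (colored t′ q d)
  SameTree⇒≈ (agree e) = same e

  SameTree⇒size : ∀ {t f t′ g} → SameTree t f t′ g → size t ≡ size t′
  SameTree⇒size (agree _) = refl

  -- The words counted by #D r h and #U r h, with every down-step carrying the color of its vertex.
  mutual
    DWord : ℕ → ℕ → Set
    DWord zero    zero    = ⊤
    DWord zero    (suc h) = Fin ℓ × DWord zero h
    DWord (suc r) zero    = UWord r zero
    DWord (suc r) (suc h) = (Fin ℓ × DWord (suc r) h) ⊎ UWord r (suc h)

    UWord : ℕ → ℕ → Set
    UWord zero    h = Fin (ℓ + m) × DWord zero h
    UWord (suc r) h = (Fin (ℓ + m) × DWord (suc r) h) ⊎ UWord r (suc h)

  mutual
    DWord↔Fin : ∀ r h → DWord r h ↔ Fin (#D r h)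
    DWord↔Fin zero    zero    = ↔-sym 1↔⊤
    DWord↔Fin zero    (suc h) = Fin-× (DWord↔Fin zero h)
    DWord↔Fin (suc r) zero    = UWord↔Fin r zero
    DWord↔Fin (suc r) (suc h) = Fin-⊎ (Fin-× (DWord↔Fin (suc r) h)) (UWord↔Fin r (suc h))

    UWord↔Fin : ∀ r h → UWord r h ↔ Fin (#U r h)
    UWord↔Fin zero    h = Fin-× (DWord↔Fin zero h)
    UWord↔Fin (suc r) h = Fin-⊎ (Fin-× (DWord↔Fin (suc r) h)) (UWord↔Fin r (suc h))

  -- A position in the walk around a forest: the ancestors from the innermost outwards, each with
  -- its color and the siblings to its right that are still to be visited.
  Stack : ℕ → Set
  Stack = Vec (Fin ℓ × List CTree)

  ∥_∥ : List CTree → ℕ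
  ∥ ts ∥ = forestSize (shapes ts)

  stackSize : ∀ {h} → Stack h → ℕ
  stackSize []             = 0
  stackSize ((_ , ts) ∷ s) = ∥ ts ∥ + stackSize s

  regroup : ∀ t us ts {h} (s : Stack h) {n} →
    suc (∥ t ∷ us ∥ + ∥ ts ∥ + stackSize s) ≡ suc n → ∥ t ∷ us ∥ + (∥ ts ∥ + stackSize s) ≡ n
  regroup t us ts s p = trans (sym (+-assoc ∥ t ∷ us ∥ ∥ ts ∥ (stackSize s))) (suc-injective p)

  mutual
    -- `ts` holds the unvisited trees at the current level. When it is empty, the innermost ancestor
    -- is left by a down-step bearing its color, and the walk resumes with that ancestor's right
    -- siblings.
    toD : ∀ r {h} ts (s : Stack h) → ∥ ts ∥ + stackSize s ≡ r → DWord r h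
    toD zero    []                   []             p = tt
    toD zero    []                   ((c , ts) ∷ s) p = c , toD zero ts s p
    toD zero    (leaf _ ∷ _)         s              ()
    toD zero    (branch _ _ _ ∷ _)   s              ()
    toD (suc r) []                   []             ()
    toD (suc r) (t ∷ ts)             []             p = toU r t ts [] p
    toD (suc r) []                   ((c , ts) ∷ s) p = inj₁ (c , toD (suc r) ts s p)
    toD (suc r) (t ∷ ts)             s@(_ ∷ _)      p = inj₂ (toU r t ts s p)

    -- The walk has just stepped up into `t`. A leaf is left at once; a branch is pushed on the
    -- stack with its color and right siblings, and the walk enters its first child.
    toU : ∀ r {h} t ts (s : Stack h) → size (shape t) + ∥ ts ∥ + stackSize s ≡ suc r → UWord r h
    toU zero    (leaf c)                    ts s p = c , toD zero ts s (suc-injective p)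
    toU zero    (branch _ (leaf _) _)       ts s ()
    toU zero    (branch _ (branch _ _ _) _) ts s ()
    toU (suc r) (leaf c)                    ts s p = inj₁ (c , toD (suc r) ts s (suc-injective p))
    toU (suc r) (branch c t us)             ts s p = inj₂ (toU r t us ((c , ts) ∷ s) (regroup t us ts s p))

  close : ∀ {h} → CTree × List CTree × Stack (suc h) → CTree × List CTree × Stack h
  close (t , us , (c , ts) ∷ s) = branch c t us , ts , s

  plant : ∀ {h} → CTree × List CTree × Stack h → List CTree × Stack h
  plant (t , ts , s) = t ∷ ts , s

  reopen : ∀ {h} → Fin ℓ → List CTree × Stack h → List CTree × Stack (suc h)
  reopen c (ts , s) = [] , (c , ts) ∷ s

  mutual
    -- The state before each step is rebuilt from the state after it: `reopen` undoes leaving an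
    -- inner vertex, and `close` undoes pushing one on the stack.
    fromD : ∀ r h → DWord r h → List CTree × Stack h
    fromD zero    zero    _              = [] , []
    fromD zero    (suc h) (c , w)        = reopen c (fromD zero h w)
    fromD (suc r) zero    w              = plant (fromU r zero w)
    fromD (suc r) (suc h) (inj₁ (c , w)) = reopen c (fromD (suc r) h w)
    fromD (suc r) (suc h) (inj₂ w)       = plant (fromU r (suc h) w)

    fromU : ∀ r h → UWord r h → CTree × List CTree × Stack h
    fromU zero    h (c , w)        = leaf c , fromD zero h w
    fromU (suc r) h (inj₁ (c , w)) = leaf c , fromD (suc r) h w
    fromU (suc r) h (inj₂ w)       = close (fromU r (suc h) w)

  sizeD : ∀ {h} → List CTree × Stack h → ℕ
  sizeD (ts , s) = ∥ ts ∥ + stackSize s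

  sizeU : ∀ {h} → CTree × List CTree × Stack h → ℕ
  sizeU (t , ts , s) = size (shape t) + ∥ ts ∥ + stackSize s

  sizeU-close : ∀ {h} (z : CTree × List CTree × Stack (suc h)) → sizeU (close z) ≡ suc (sizeU z)
  sizeU-close (t , us , (c , ts) ∷ s) = cong suc (+-assoc ∥ t ∷ us ∥ ∥ ts ∥ (stackSize s))

  mutual
    sizeD-fromD : ∀ r h w → sizeD (fromD r h w) ≡ r
    sizeD-fromD zero    zero    w              = refl
    sizeD-fromD zero    (suc h) (c , w)        = sizeD-fromD zero h w
    sizeD-fromD (suc r) zero    w              = sizeU-fromU r zero w
    sizeD-fromD (suc r) (suc h) (inj₁ (c , w)) = sizeD-fromD (suc r) h w
    sizeD-fromD (suc r) (suc h) (inj₂ w)       = sizeU-fromU r (suc h) w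

    sizeU-fromU : ∀ r h w → sizeU (fromU r h w) ≡ suc r
    sizeU-fromU zero    h (c , w)        = cong suc (sizeD-fromD zero h w)
    sizeU-fromU (suc r) h (inj₁ (c , w)) = cong suc (sizeD-fromD (suc r) h w)
    sizeU-fromU (suc r) h (inj₂ w)       = trans (sizeU-close (fromU r (suc h) w)) (cong suc (sizeU-fromU r (suc h) w))

  mutual
    fromD-toD : ∀ r {h} ts (s : Stack h) p → fromD r h (toD r ts s p) ≡ (ts , s)
    fromD-toD zero    []                 []             p = refl
    fromD-toD zero    []                 ((c , ts) ∷ s) p = cong (reopen c) (fromD-toD zero ts s p)
    fromD-toD zero    (leaf _ ∷ _)       s              ()
    fromD-toD zero    (branch _ _ _ ∷ _) s              ()
    fromD-toD (suc r) []                 []             ()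
    fromD-toD (suc r) (t ∷ ts)           []             p = cong plant (fromU-toU r t ts [] p)
    fromD-toD (suc r) []                 ((c , ts) ∷ s) p = cong (reopen c) (fromD-toD (suc r) ts s p)
    fromD-toD (suc r) (t ∷ ts)           s@(_ ∷ _)      p = cong plant (fromU-toU r t ts s p)

    fromU-toU : ∀ r {h} t ts (s : Stack h) p → fromU r h (toU r t ts s p) ≡ (t , ts , s)
    fromU-toU zero    (leaf c)                    ts s p = cong (leaf c ,_) (fromD-toD zero ts s (suc-injective p))
    fromU-toU zero    (branch _ (leaf _) _)       ts s ()
    fromU-toU zero    (branch _ (branch _ _ _) _) ts s ()
    fromU-toU (suc r) (leaf c)                    ts s p = cong (leaf c ,_) (fromD-toD (suc r) ts s (suc-injective p))
    fromU-toU (suc r) (branch c t us)             ts s p =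
      cong close (fromU-toU r t us ((c , ts) ∷ s) (regroup t us ts s p))

  mutual
    toD-fromD : ∀ r h w p → toD r (proj₁ (fromD r h w)) (proj₂ (fromD r h w)) p ≡ w
    toD-fromD zero    zero    tt             p = refl
    toD-fromD zero    (suc h) (c , w)        p = cong (c ,_) (toD-fromD zero h w p)
    -- The rebuilt state is generalized together with the induction hypothesis, so that its stack
    -- can be matched and `toD` computes.
    toD-fromD (suc r) zero    w              p with fromU r zero w | toU-fromU r zero w
    ... | t , ts , [] | ih = ih p
    toD-fromD (suc r) (suc h) (inj₁ (c , w)) p = cong (λ w → inj₁ (c , w)) (toD-fromD (suc r) h w p)
    toD-fromD (suc r) (suc h) (inj₂ w)       p with fromU r (suc h) w | toU-fromU r (suc h) w
    ... | t , ts , _ ∷ s | ih = cong inj₂ (ih p)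

    toU-fromU : ∀ r h w p →
      toU r (proj₁ (fromU r h w)) (proj₁ (proj₂ (fromU r h w))) (proj₂ (proj₂ (fromU r h w))) p ≡ w
    toU-fromU zero    h (c , w)        p = cong (c ,_) (toD-fromD zero h w (suc-injective p))
    toU-fromU (suc r) h (inj₁ (c , w)) p = cong (λ w → inj₁ (c , w)) (toD-fromD (suc r) h w (suc-injective p))
    toU-fromU (suc r) h (inj₂ w)       p with fromU r (suc h) w | toU-fromU r (suc h) w
    ... | t , us , (c , ts) ∷ s | ih = cong inj₂ (ih (regroup t us ts s p))

  -- Bijection between colored trees and words

  encode-unique : ∀ u {t c} → SameTree (shape u) (vertexColor u) t (color c) → encode t c ≡ u
  encode-unique u {c = c} (agree e) = encode-decode u c (sym ∘ e)

  -- The decoding of `encode t d` agrees pointwise with `d`, hence with `c`, and an encoding is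
  -- determined by the pointwise values. No function extensionality is involved.
  encode-cong : ∀ {t} {c d : Coloring (S ℓ m) t} → (∀ v → color c v ≡ color d v) → encode t c ≡ encode t d
  encode-cong {t} {c} {d} c≗d = encode-unique (encode t d) (relabel (decode-encode t d) (sym ∘ c≗d))
    where
    relabel : ∀ {t f t′ g g′} → SameTree t f t′ g → (∀ v → g v ≡ g′ v) → SameTree t f t′ g′
    relabel (agree e) g≗g′ = agree λ v → trans (e v) (g≗g′ v)

  -- With at least two vertices the root is a branch. Its color is set aside, and the forest of its
  -- `suc r` proper descendants becomes the word.
  treeWord : ∀ r u → size (shape u) ≡ suc (suc r) → Fin ℓ × UWord r 0
  treeWord r (leaf _)        ()
  treeWord r (branch c t ts) p = c , toU r t ts [] (trans (+-identityʳ _) (suc-injective p))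

  treeWord-cong : ∀ r {u u′} p p′ → u ≡ u′ → treeWord r u p ≡ treeWord r u′ p′
  treeWord-cong r {u} p p′ refl = cong (treeWord r u) (≡-irrelevant p p′)

  graft : Fin ℓ → CTree × List CTree × Stack 0 → CTree
  graft c (t , ts , []) = branch c t ts

  wordTree : ∀ r → Fin ℓ × UWord r 0 → CTree
  wordTree r (c , w) = graft c (fromU r 0 w)

  size-graft : ∀ c z → size (shape (graft c z)) ≡ suc (sizeU z)
  size-graft c (t , ts , []) = cong suc (sym (+-identityʳ _))

  size-wordTree : ∀ r w → size (shape (wordTree r w)) ≡ suc (suc r)
  size-wordTree r (c , w) = trans (size-graft c (fromU r 0 w)) (cong suc (sizeU-fromU r 0 w))

  wordTree-treeWord : ∀ r u p → wordTree r (treeWord r u p) ≡ u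
  wordTree-treeWord r (leaf _)        ()
  wordTree-treeWord r (branch c t ts) p = cong (graft c) (fromU-toU r t ts [] _)

  treeWord-wordTree : ∀ r w p → treeWord r (wordTree r w) p ≡ w
  treeWord-wordTree r (c , w) p with fromU r 0 w | toU-fromU r 0 w
  ... | t , ts , [] | ih = cong (c ,_) (ih _)

  coloredTrees↔words : ∀ r → Inverse (coloredTrees (S ℓ m) (suc (suc r))) (setoid (Fin ℓ × UWord r 0))
  coloredTrees↔words r = record
    { to        = to
    ; from      = from
    ; to-cong   = to-cong
    ; from-cong = λ { refl → same λ _ → refl }
    ; inverse   = (λ {w} z≈ → trans (to-cong z≈) (to-from w)) , λ { {z} refl → from-to z }
    }
    where
    size-encode : ∀ t c → size (shape (encode t c)) ≡ size t
    size-encode t c = SameTree⇒size (decode-encode t c)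

    to : ColoredTree (S ℓ m) (suc (suc r)) → Fin ℓ × UWord r 0
    to (colored t p c) = treeWord r (encode t c) (trans (size-encode t c) p)

    from : Fin ℓ × UWord r 0 → ColoredTree (S ℓ m) (suc (suc r))
    from w = colored (shape (wordTree r w)) (size-wordTree r w) (decode (wordTree r w))

    to-cong : ∀ {z z′} → z ≈ z′ → to z ≡ to z′
    to-cong (same e) = treeWord-cong r _ _ (encode-cong e)

    to-from : ∀ w → to (from w) ≡ w
    to-from w = trans
      (treeWord-cong r _ (size-wordTree r w) (encode-decode (wordTree r w) (decode (wordTree r w)) λ _ → refl))
      (treeWord-wordTree r w (size-wordTree r w))

    from-to : ∀ z → from (to z) ≈ z
    from-to (colored t p c) = SameTree⇒≈
      (subst (λ u → SameTree (shape u) (vertexColor u) t (color c))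
        (sym (wordTree-treeWord r (encode t c) _)) (decode-encode t c))

  treeCount : ∀ r → IsTreeCount (S ℓ m) (suc (suc r)) (ℓ * #U r 0)
  treeCount r = coloredTrees↔words r ⟫ Fin-× (UWord↔Fin r 0)

-- Passage to the rationals

-- Transferred from the homomorphism property of `toℚᵘ`, as the two conversions are mutually inverse
-- up to equality of fractions.
fromℚᵘ-homo-+ : ∀ p q → fromℚᵘ (p ℚᵘ.+ q) ≡ fromℚᵘ p +ℚ fromℚᵘ q
fromℚᵘ-homo-+ p q = trans
  (ℚ.fromℚᵘ-cong (ℚᵘ.≃-sym (ℚᵘ.≃-trans (ℚ.toℚᵘ-homo-+ (fromℚᵘ p) (fromℚᵘ q))
    (ℚᵘ.+-cong (ℚ.toℚᵘ-fromℚᵘ p) (ℚ.toℚᵘ-fromℚᵘ q)))))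
  (ℚ.fromℚᵘ-toℚᵘ _)

fromℚᵘ-homo-* : ∀ p q → fromℚᵘ (p ℚᵘ.* q) ≡ fromℚᵘ p *ℚ fromℚᵘ q
fromℚᵘ-homo-* p q = trans
  (ℚ.fromℚᵘ-cong (ℚᵘ.≃-sym (ℚᵘ.≃-trans (ℚ.toℚᵘ-homo-* (fromℚᵘ p) (fromℚᵘ q))
    (ℚᵘ.*-cong (ℚ.toℚᵘ-fromℚᵘ p) (ℚ.toℚᵘ-fromℚᵘ q)))))
  (ℚ.fromℚᵘ-toℚᵘ _)

ι : ℕ → ℚᵘ.ℚᵘ
ι n = mkℚᵘ (ℤ.+ n) 0

fromℕ-+ : ∀ a b → fromℕ (a + b) ≡ fromℕ a +ℚ fromℕ b
fromℕ-+ a b = trans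
  (ℚ.fromℚᵘ-cong {ι (a + b)} {ι a ℚᵘ.+ ι b} (*≡* (s (ℤ.+ a) (ℤ.+ b))))
  (fromℚᵘ-homo-+ (ι a) (ι b))
  where
  s : ∀ a b → (a ℤ.+ b) ℤ.* ℤ.+ 1 ≡ (a ℤ.* ℤ.+ 1 ℤ.+ b ℤ.* ℤ.+ 1) ℤ.* ℤ.+ 1
  s = ℤ-Solver.solve-∀

fromℕ-* : ∀ a b → fromℕ (a * b) ≡ fromℕ a *ℚ fromℕ b
fromℕ-* a b = trans
  (ℚ.fromℚᵘ-cong {ι (a * b)} {ι a ℚᵘ.* ι b} (*≡* (cong (ℤ._* ℤ.+ 1) (pos-* a b))))
  (fromℚᵘ-homo-* (ι a) (ι b))

1/n*n≡1 : ∀ r → (ℤ.+ 1 / suc r) *ℚ fromℕ (suc r) ≡ 1ℚ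
1/n*n≡1 r = trans (sym (fromℚᵘ-homo-* (mkℚᵘ (ℤ.+ 1) r) (ι (suc r))))
  (ℚ.fromℚᵘ-cong {mkℚᵘ (ℤ.+ 1) r ℚᵘ.* ι (suc r)} {ι 1} (*≡* (cong ℤ.+_ (s r))))
  where
  s : ∀ r → (suc r + 0) * 1 ≡ (suc r * 1) + 0
  s = solve-∀

-- Pulls the common factor 1/(n-1) out of the rational sum, leaving a sum of natural numbers.
sum-fromℕ : ∀ c (f g p q : ℕ → ℕ) ks →
  foldr _+ℚ_ 0ℚ (map (λ k → c *ℚ fromℕ (f k) *ℚ fromℕ (g k) *ℚ fromℕ (p k) *ℚ fromℕ (q k)) ks)
    ≡ c *ℚ fromℕ (sum (map (λ k → f k * g k * p k * q k) ks))
sum-fromℕ c f g p q []       = sym (ℚ.*-zeroʳ c)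
sum-fromℕ c f g p q (k ∷ ks) = begin
  c *ℚ fromℕ (f k) *ℚ fromℕ (g k) *ℚ fromℕ (p k) *ℚ fromℕ (q k) +ℚ foldr _+ℚ_ 0ℚ (map _ ks)
    ≡⟨ cong₂ _+ℚ_ (cong (λ z → z *ℚ fromℕ (p k) *ℚ fromℕ (q k)) (merge (f k) (g k))) (sum-fromℕ c f g p q ks) ⟩
  c *ℚ fromℕ (f k * g k) *ℚ fromℕ (p k) *ℚ fromℕ (q k) +ℚ c *ℚ fromℕ s
    ≡⟨ cong (λ z → z *ℚ fromℕ (q k) +ℚ c *ℚ fromℕ s) (merge (f k * g k) (p k)) ⟩
  c *ℚ fromℕ (f k * g k * p k) *ℚ fromℕ (q k) +ℚ c *ℚ fromℕ s
    ≡⟨ cong (_+ℚ c *ℚ fromℕ s) (merge (f k * g k * p k) (q k)) ⟩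
  c *ℚ fromℕ (f k * g k * p k * q k) +ℚ c *ℚ fromℕ s
    ≡⟨ ℚ.*-distribˡ-+ c _ _ ⟨
  c *ℚ (fromℕ (f k * g k * p k * q k) +ℚ fromℕ s)
    ≡⟨ cong (c *ℚ_) (fromℕ-+ (f k * g k * p k * q k) s) ⟨
  c *ℚ fromℕ (f k * g k * p k * q k + s) ∎
  where
  open ≡-Reasoning
  s = sum (map (λ k → f k * g k * p k * q k) ks)
  merge : ∀ a b → c *ℚ fromℕ a *ℚ fromℕ b ≡ c *ℚ fromℕ (a * b)
  merge a b = trans (ℚ.*-assoc c (fromℕ a) (fromℕ b)) (cong (c *ℚ_) (sym (fromℕ-* a b)))

-- The count as a Narayana sum

module _ (ℓ m r : ℕ) where

  open Weights ℓ (ℓ + m)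

  -- The summand of the theorem for n = r + 2, multiplied by n - 1 to clear the denominator.
  narayanaTerm : ℕ → ℕ
  narayanaTerm k = (suc r C k) * (suc r C (k ∸ 1)) * ℓ ^ (suc (suc r) ∸ k) * (ℓ + m) ^ k

  count-narayanaTerm : sum (map narayanaTerm (applyUpTo suc (suc r))) ≡ suc r * (ℓ * #U r 0)
  count-narayanaTerm = begin
    sum (map narayanaTerm (applyUpTo suc (suc r)))
      ≡⟨ cong sum (map-applyUpTo suc narayanaTerm (suc r)) ⟩
    sum (applyUpTo (narayanaTerm ∘ suc) (suc r))
      ≡⟨ sum≡eval r (λ j → (suc r C suc j) * (suc r C j)) ⟩
    ℓ * ((ℓ + m) * eval r (λ j → (suc r C suc j) * (suc r C j)))
      ≡⟨ cong (ℓ *_) (#U-narayana r) ⟨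
    ℓ * (suc r * #U r 0)
      ≡⟨ s ℓ (suc r) (#U r 0) ⟩
    suc r * (ℓ * #U r 0) ∎
    where
    open ≡-Reasoning
    s : ∀ a b c → a * (b * c) ≡ b * (a * c)
    s = solve-∀

  count-formula : fromℕ (ℓ * #U r 0) ≡
    ∑₁ (suc r) (λ k → narayana (suc r) k *ℚ fromℕ (ℓ ^ (suc (suc r) ∸ k)) *ℚ fromℕ ((ℓ + m) ^ k))
  count-formula = begin
    fromℕ t                             ≡⟨ ℚ.*-identityˡ (fromℕ t) ⟨
    1ℚ *ℚ fromℕ t                       ≡⟨ cong (_*ℚ fromℕ t) (1/n*n≡1 r) ⟨
    c *ℚ fromℕ (suc r) *ℚ fromℕ t       ≡⟨ ℚ.*-assoc c _ _ ⟩
    c *ℚ (fromℕ (suc r) *ℚ fromℕ t)     ≡⟨ cong (c *ℚ_) (fromℕ-* (suc r) t) ⟨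
    c *ℚ fromℕ (suc r * t)              ≡⟨ cong (λ z → c *ℚ fromℕ z) count-narayanaTerm ⟨
    c *ℚ fromℕ (sum (map narayanaTerm (applyUpTo suc (suc r))))
      ≡⟨ sum-fromℕ c (suc r C_) (λ k → suc r C (k ∸ 1)) (λ k → ℓ ^ (suc (suc r) ∸ k)) ((ℓ + m) ^_)
           (applyUpTo suc (suc r)) ⟨
    ∑₁ (suc r) (λ k → narayana (suc r) k *ℚ fromℕ (ℓ ^ (suc (suc r) ∸ k)) *ℚ fromℕ ((ℓ + m) ^ k)) ∎
    where
    open ≡-Reasoning
    t = ℓ * #U r 0
    c = ℤ.+ 1 / suc r

open import Data.Integer.Base using (+_)

theorem32 : ∀ (ℓ m : ℕ) → 0 < ℓ → 0 < m → ∀ (n : ℕ) (1<n : 1 < n) →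
    let instance _ = 1<n⇒n∸1≢0 1<n in
    ∃[ t ]
    IsTreeCount (S ℓ m) n t
    × fromℕ t ≡ ∑₁ (n ∸ 1) (λ k → narayana (n ∸ 1) k *ℚ fromℕ (ℓ ^ (n ∸ k)) *ℚ fromℕ ((ℓ + m) ^ k))
    × ∑₁ (n ∸ 1) (λ k → narayana (n ∸ 1) k *ℚ fromℕ (ℓ ^ (n ∸ k)) *ℚ fromℕ ((ℓ + m) ^ k))
    ≡ ∑₁ (n ∸ 1) (λ k → (+ 1 / (n ∸ 1)) *ℚ fromℕ ((n ∸ 1) C k) *ℚ fromℕ ((n ∸ 1) C (k ∸ 1)) *ℚ fromℕ (ℓ ^ (n ∸ k)) *ℚ fromℕ ((ℓ + m) ^ k))
theorem32 ℓ m _ _ (suc (suc r)) (s≤s (s≤s _)) =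
  -- There are `ℓ` colors for the root, and `#U` counts the colored forests below it. The last
  -- equation holds by unfolding `narayana`.
  ℓ * Weights.#U ℓ (ℓ + m) r 0 , Encoding.treeCount ℓ m r , count-formula ℓ m r , refl
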